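{- Let $n$ and $m\ge2$ be positive integers. (I) Let $K=(k_1,\dots,k_m)$ be a given tuple of positive integers, $a=\sum_{i}k_i$, $\widetilde{k}=\mathrm{lcm}(k_1,\dots,k_m)$, and let $\rho_{(n,m,K)}$ denote the smallest possible $\rho$ for weak $(n,m,a,\rho)$-AMD codes whose encoding sets have sizes $k_1,\dots,k_m$. Then a weak $(n,m,a,\rho)$-AMD code $(S,G,\mathcal{A},E_u)$ with $S=\{s_i:1\le i\le m\}$, $\mathcal{A}=\{A_{s_i}:1\le i\le m\}$ and $|A_{s_i}|=k_i$ satisfies $\rho=\rho_{(n,m,K)}$ if and only if its corresponding BSWEDF $\{A_{s_i}:1\le i\le m\}$, with parameters $(n,m,K,a,\lambda=\widetilde{k}m\rho)$, is optimal. (II) For given $a$, there exists a weak $(n,m,a,\rho)$-AMD code $(S,G,\mathcal{A},E_u)$ with $\rho=\rho_{(n,m,a)}$ if and only if there exists a strongly optimal $(n,m,K,a,\lambda)$-BSWEDF, with $\lambda=\widetilde{k}m\rho_{(n,m,a)}$, for some $K=(k_1,\dots,k_m)$ with $\sum_i k_i=a$ and $\widetilde{k}=\mathrm{lcm}(k_1,\dots,k_m)$. (III) For given $a$, there exists a weak $(n,m,a,\rho)$-AMD code $(S,G,\mathcal{A},E_u)$ with $\rho=\frac{a(m-1)}{m(n-1)}$ if and only if there exists an $(n,m,K,a,\lambda)$-SWEDF, with $\lambda=\frac{\widetilde{k}a(m-1)}{n-1}$, for some $K=(k_1,\dots,k_m)$ with $\sum_i k_i=a$ and $\widetilde{k}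=\mathrm{lcm}(k_1,\dots,k_m)$.
   Context: All groups are written additively with identity $0$; codes and families are over Abelian groups $G$ of order $n$. Weak AMD code: let $S$ be a set of $m$ source messages, $G$ an Abelian group of order $n$, and $\mathcal{A}=\{A_s : s\in S\}$ a family of pairwise disjoint nonempty subsets of $G$. A source $s\in S$ is chosen uniformly at random, and $E_u$ encodes $s$ as a uniformly random $g\in A_s$. The adversary, with no knowledge of $s$ or $g$, chooses $\Delta\in G\setminus\{0\}$ and wins if $g+\Delta\in A_{s'}$ for some $s'\neq s$. Let $\rho_\Delta$ be the probability of winning with $\Delta$, i.e. $\rho_\Delta=\frac1m\sum_{s\in S}\frac{1}{|A_s|}\,|\{g\in A_s : g+\Delta\in\bigcup_{s'\ne s}A_{s'}\}|$. Then $(S,G,\mathcal{A},E_u)$ is a weak $(n,m,a,\rho)$-AMD code, where $a=\sum_{s\in S}|A_s|$ and $\rho=\max\{\rho_\Delta : \Delta\in G\setminus\{0\}\}$. (A code as in (II) is called $R$-optimal with respect to the bound $\rho\ge\rho_{(n,m,a)}$; a code as in (III) is called $R$-optimal with respect to the Paterson–Stinson bound $\rho\ge\frac{a(m-1)}{m(n-1)}$.) BSWEDF and SWEDF: for multi-sets $B_1,B_2$ of elements of $G$, $D(B_1,B_2)$ is the multi-set $\{x-y : x\in B_1,\ y\in B_2\}$; $k\boxtimes B$ is the multi-set in which each element of $B$ is repeated $k$ times; unions are multi-set unions. Let $\mathcal{B}=\{B_i : 1\le i\le m\}$ be a family of pairwise disjoint nonempty subsets of $G$, $k_i=|B_i|$,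 $K=(k_1,\dots,k_m)$, $a=\sum_i k_i$, $\widetilde{k}=\mathrm{lcm}(k_1,\dots,k_m)$, $\widetilde{B}_i=\frac{\widetilde{k}}{k_i}\boxtimes B_i$. Then $\mathcal{B}$ is an $(n,m,K,a,\lambda)$-BSWEDF if $\lambda$ is the smallest positive integer such that $\bigcup_{1\le i\ne j\le m}D(B_i,\widetilde{B}_j)\subseteq\lambda\boxtimes(G\setminus\{0\})$; it is an $(n,m,K,a,\lambda)$-SWEDF if moreover $\bigcup_{1\le i\ne j\le m}D(B_i,\widetilde{B}_j)=\lambda\boxtimes(G\setminus\{0\})$. An $(n,m,K,a,\lambda)$-BSWEDF is optimal if $\lambda$ takes the smallest possible value for the given $n,m,K$. Define $\rho_{(n,m,a)}=\min_{K'}\{\frac{\lambda'}{\widetilde{k'}m} : \text{there exists an }(n,m,K',a,\lambda')\text{ -BSWEDF with }\sum_i k'_i=a\}$, where $\widetilde{k'}=\mathrm{lcm}(k'_1,\dots,k'_m)$. For given $n,m,a$, an $(n,m,K,a,\lambda)$-BSWEDF is strongly optimal if $\frac{\lambda}{\widetilde{k}m}=\rho_{(n,m,a)}$. -}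

module Defs where

open import Algebra.Bundles using (AbelianGroup)
open import Data.Fin as Fin using (Fin)
open import Data.Integer.Base using (+_)
open import Data.List.Base using (List; map; filter; length; concatMap; replicate; cartesianProduct; cartesianProductWith; allFin)
open import Data.Nat.Base as ℕ using (ℕ; zero; suc; NonZero; _∸_)
open import Data.Nat.LCM using (lcm; gcd*lcm)
open import Data.Nat.GCD using (gcd)
import Data.Nat.Properties as ℕ
open import Data.Product using (Σ; ∃; ∃-syntax; Σ-syntax; _×_; _,_)
open import Data.Rational.Base as ℚ using (ℚ)
import Data.Rational.Properties as ℚ
open import Data.Vec.Functional using (Vector; foldr)
open import Function.Base using (flip; _∘_)
open import Function.Bundles using (Inverse; Injection; _↔_)
open import Function.Properties.Inverse using (↔-sym; Inverse⇒Injection)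
import Function.Construct.Symmetry as Symmetry
open import Level using (Level; 0ℓ; _⊔_)
open import Relation.Binary.Core using (Rel)
open import Relation.Binary.Definitions using (Decidable)
open import Relation.Binary.PropositionalEquality as ≡ using (_≡_; _≢_)
open import Relation.Nullary.Decidable using (¬?; via-injection)
open import Relation.Unary using (Pred)

import Algebra.Properties.CommutativeMonoid.Sum as Sum
import Data.List.Membership.DecSetoid as DecMembership
import Data.List.Relation.Binary.Disjoint.Setoid as SetoidDisjoint
import Data.List.Relation.Unary.Unique.Setoid as SetoidUnique
open import Relation.Binary.Bundles using (DecSetoid)

open Sum ℕ.+-0-commutativeMonoid public using () renaming (sum to sumℕ)
open Sum ℚ.+-0-commutativeMonoid public using () renaming (sum to sumℚ)

private
  variable
    a p r : Level
    A : Set a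
    n m : ℕ

IsLeast : Rel A r → Pred A p → Pred A _
IsLeast _≤_ P x = P x × (∀ y → P y → x ≤ y)

IsGreatest : Rel A r → Pred A p → Pred A _
IsGreatest _≤_ = IsLeast (flip _≤_)

fromℕ : ℕ → ℚ
fromℕ k = + k ℚ./ 1

record Sizes (m : ℕ) : Set where
  field
    size     : Vector ℕ m
    positive : ∀ i → NonZero (size i)

open Sizes public

total : Sizes m → ℕ
total K = sumℕ (size K)

lcms : Vector ℕ m → ℕ
lcms = foldr lcm 1

k̃ : Sizes m → ℕ
k̃ K = lcms (size K)

lcms-nonZero : ∀ m (k : Vector ℕ m) → (∀ i → NonZero (k i)) → NonZero (lcms k)
lcms-nonZero zero    k k≢0 = _
lcms-nonZero (suc m) k k≢0 = ℕ.m*n≢0⇒n≢0 (gcd k₀ l)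
  {{≡.subst NonZero (≡.sym (gcd*lcm k₀ l)) (ℕ.m*n≢0 k₀ l {{k≢0 Fin.zero}} {{l≢0}})}}
  where
  k₀ = k Fin.zero
  l  = lcms (k ∘ Fin.suc)
  l≢0 : NonZero l
  l≢0 = lcms-nonZero m (k ∘ Fin.suc) (k≢0 ∘ Fin.suc)

record FiniteAbelianGroup (n : ℕ) : Set₁ where
  field
    abelianGroup : AbelianGroup 0ℓ 0ℓ

  open AbelianGroup abelianGroup public
    renaming (_∙_ to _⊕_; _-_ to _⊖_; ε to 𝟘; _⁻¹ to ⊖_)

  field
    enumeration : Inverse (≡.setoid (Fin n)) setoid

  infix 4 _≟_
  _≟_ : Decidable _≈_
  _≟_ = via-injection (Inverse⇒Injection (Symmetry.inverse enumeration)) Fin._≟_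

  decSetoid : DecSetoid 0ℓ 0ℓ
  decSetoid = record
    { isDecEquivalence = record { isEquivalence = isEquivalence ; _≟_ = _≟_ } }

  open DecMembership decSetoid public using (_∈_; _∈?_)
  open SetoidDisjoint setoid public using (Disjoint)
  open SetoidUnique setoid public using (Unique)

  -- A multi-set of group elements is a list whose order is ignored, and a
  -- subset of the group is a multi-set without repetitions (Unique).

  MultiSet : Set
  MultiSet = List Carrier

  multiplicity : Carrier → MultiSet → ℕ
  multiplicity x B = length (filter (x ≟_) B)

  infix 4 _⊆ₘ_ _≈ₘ_
  _⊆ₘ_ _≈ₘ_ : Rel MultiSet 0ℓ
  B ⊆ₘ C = ∀ x → multiplicity x B ℕ.≤ multiplicity x C
  B ≈ₘ C = ∀ x → multiplicity x B ≡ multiplicity x C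

  infixr 7 _⊠_
  _⊠_ : ℕ → MultiSet → MultiSet
  k ⊠ B = concatMap (replicate k) B

  D : MultiSet → MultiSet → MultiSet
  D = cartesianProductWith _⊖_

  G∖0 : MultiSet
  G∖0 = filter (λ x → ¬? (x ≟ 𝟘)) (map (Inverse.to enumeration) (allFin n))

record DisjointFamily (G : FiniteAbelianGroup n) (I : Set) : Set where
  open FiniteAbelianGroup G
  field
    block    : I → List Carrier
    unique   : ∀ i → Unique (block i)
    nonempty : ∀ i → NonZero (length (block i))
    disjoint : ∀ {i j} → i ≢ j → Disjoint (block i) (block j)

  card : I → ℕ
  card i = length (block i)

reindex : {G : FiniteAbelianGroup n} {I J : Set} →
          I ↔ J → DisjointFamily G J → DisjointFamily G I
reindex I↔J 𝓑 = record
  { block    = block ∘ to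
  ; unique   = unique ∘ to
  ; nonempty = nonempty ∘ to
  ; disjoint = λ i≢j → disjoint (i≢j ∘ injective)
  }
  where
  open DisjointFamily 𝓑
  open Injection (Inverse⇒Injection I↔J) using (to; injective)

sizes : {G : FiniteAbelianGroup n} → DisjointFamily G (Fin m) → Sizes m
sizes 𝓑 = record { size = card ; positive = nonempty }
  where open DisjointFamily 𝓑

HasSizes : {G : FiniteAbelianGroup n} → DisjointFamily G (Fin m) → Pred (Sizes m) 0ℓ
HasSizes 𝓑 K = ∀ i → size (sizes 𝓑) i ≡ size K i

-- The encoding rule E_u is determined by the family 𝓐; sources lists S as
-- s₁, …, sₘ.
record WeakAMDCode (n m : ℕ) : Set₁ where
  field
    S       : Set
    sources : Fin m ↔ S
    G       : FiniteAbelianGroup n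
    𝓐       : DisjointFamily G S

  open FiniteAbelianGroup G
  open DisjointFamily 𝓐

  family : DisjointFamily G (Fin m)
  family = reindex sources 𝓐

  private
    infix 4 _≟ₛ_
    _≟ₛ_ : Decidable {A = S} _≡_
    _≟ₛ_ = via-injection (Inverse⇒Injection (↔-sym sources)) Fin._≟_

  others : S → List Carrier
  others s = concatMap block
    (filter (λ s′ → ¬? (s′ ≟ₛ s)) (map (Inverse.to sources) (allFin m)))

  wins : Carrier → S → ℕ
  wins Δ s = length (filter (λ g → (g ⊕ Δ) ∈? others s) (block s))

  winProbability : .{{NonZero m}} → Carrier → ℚ
  winProbability Δ = (+ 1 ℚ./ m) ℚ.* sumℚ (term ∘ Inverse.to sources)
    where
    term : S → ℚ
    term s = (+ 1 ℚ./ card s) {{nonempty s}} ℚ.* fromℕ (wins Δ s)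

record IsWeakAMD .{{_ : NonZero m}} (𝓒 : WeakAMDCode n m) (a : ℕ) (ρ : ℚ) : Set where
  open WeakAMDCode 𝓒
  open FiniteAbelianGroup G using (Carrier; _≉_; 𝟘)
  field
    total-size : total (sizes family) ≡ a
    maximal    : IsGreatest ℚ._≤_ (λ x → Σ[ Δ ∈ Carrier ] Δ ≉ 𝟘 × x ≡ winProbability Δ) ρ

-- ρ = ρ_(n,m,K): the minimum ranges over all groups of order n.
IsMinRhoOfSizes : ∀ n m .{{_ : NonZero m}} → Sizes m → ℚ → Set₁
IsMinRhoOfSizes n m K = IsLeast ℚ._≤_ λ ρ →
  Σ[ 𝓒 ∈ WeakAMDCode n m ] HasSizes (WeakAMDCode.family 𝓒) K × IsWeakAMD 𝓒 (total K) ρ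

module _ {G : FiniteAbelianGroup n} (𝓑 : DisjointFamily G (Fin m)) where
  open FiniteAbelianGroup G hiding (_≟_)
  open DisjointFamily 𝓑

  B̃ : Fin m → MultiSet
  B̃ j = (k̃ (sizes 𝓑) ℕ./ card j) {{nonempty j}} ⊠ block j

  externalDifferences : MultiSet
  externalDifferences = concatMap (λ (i , j) → D (block i) (B̃ j))
    (filter (λ (i , j) → ¬? (i Fin.≟ j)) (cartesianProduct (allFin m) (allFin m)))

  record IsBSWEDF (K : Sizes m) (a l : ℕ) : Set where
    field
      has-sizes  : HasSizes 𝓑 K
      total-size : total K ≡ a
      minimal    : IsLeast ℕ._≤_ (λ l → 0 ℕ.< l × externalDifferences ⊆ₘ l ⊠ G∖0) l

  record IsSWEDF (K : Sizes m) (a l : ℕ) : Set where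
    field
      isBSWEDF : IsBSWEDF K a l
      exact    : externalDifferences ≈ₘ l ⊠ G∖0

BSWEDFExists : ∀ n m → Sizes m → (a l : ℕ) → Set₁
BSWEDFExists n m K a l =
  Σ[ G ∈ FiniteAbelianGroup n ] Σ[ 𝓑 ∈ DisjointFamily G (Fin m) ] IsBSWEDF 𝓑 K a l

Optimal : ∀ n m → Sizes m → ℕ → Set₁
Optimal n m K = IsLeast ℕ._≤_ (BSWEDFExists n m K (total K))

normalised : ∀ m .{{_ : NonZero m}} → Sizes m → ℕ → ℚ
normalised m K l = (+ l ℚ./ (k̃ K ℕ.* m)) {{ℕ.m*n≢0 _ m {{lcms-nonZero m (size K) (positive K)}}}}

-- ρ = ρ_(n,m,a): the minimum ranges over all groups of order n and all tuples K
-- of sum a (IsBSWEDF fixes the sum).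
IsMinRho : ∀ n m .{{_ : NonZero m}} → ℕ → ℚ → Set₁
IsMinRho n m a = IsLeast ℚ._≤_ λ ρ →
  ∃[ K ] ∃[ l ] BSWEDFExists n m K a l × ρ ≡ normalised m K l

StronglyOptimal : ∀ n m .{{_ : NonZero m}} → (a : ℕ) → Sizes m → ℕ → Set₁
StronglyOptimal n m a K l = IsMinRho n m a (normalised m K l)

patersonStinson : ∀ n m .{{_ : NonZero (n ∸ 1)}} .{{_ : NonZero m}} → ℕ → ℚ
patersonStinson n m a = (+ (a ℕ.* (m ∸ 1)) ℚ./ (m ℕ.* (n ∸ 1))) {{ℕ.m*n≢0 m (n ∸ 1)}}

{-# OPTIONS --safe #-}

-- Writing M(Δ) for the multiplicity of Δ among the weighted external differences
-- of a family, double counting the pairs (u , g) with u = g + Δ gives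
-- M(Δ) = k̃ m ρ_Δ.  Disjointness of the blocks gives M(0) = 0, and for m ≥ 2 some
-- M(Δ) is positive, so the least positive λ of a BSWEDF is the maximum of M over
-- Δ ≠ 0, that is λ = k̃ m ρ.  This gives (I) and (II), since codes and families
-- determine each other.  For (III), the external differences number
-- k̃ a (m − 1), so the Paterson–Stinson value of ρ makes the bound M ≤ λ tight for
-- every Δ ≠ 0.

module Submission where

open import Defs
open import Algebra.Bundles using (CommutativeRing)
open import Data.Bool.Base using (true; false; if_then_else_)
open import Data.Fin.Base as Fin using (Fin)
import Data.Fin.Properties as Fin
open import Data.Integer.Base as ℤ using (+_)
import Data.Integer.Properties as ℤ
open import Data.List.Base using (List; []; _∷_; _++_; map; filter; length; tabulate;
  concatMap; replicate; cartesianProductWith; cartesianProduct; allFin)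
import Data.List.Membership.DecSetoid as DecMembership
open import Data.List.Membership.Propositional using () renaming (_∈_ to _∈ₚ_)
open import Data.List.Membership.Propositional.Properties using (∈-map⁺; ∈-allFin)
import Data.List.Membership.Setoid.Properties as SetoidMembership
import Data.List.Properties as List
import Data.List.Relation.Unary.All as All
import Data.List.Relation.Unary.All.Properties as All
open import Data.List.Relation.Unary.AllPairs as AllPairs using (AllPairs; []; _∷_)
import Data.List.Relation.Unary.AllPairs.Properties as AllPairs
open import Data.List.Relation.Unary.Any as Any using (here; there)
import Data.List.Relation.Unary.Unique.Propositional.Properties as Unique
import Data.List.Relation.Unary.Unique.Setoid as Setoid
import Data.List.Relation.Unary.Unique.Setoid.Properties as SetoidUnique
open import Data.Nat.Base as ℕ using (ℕ; zero; suc; NonZero; _≤_; _+_; _*_; _∸_; z≤n)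
open import Data.Nat.Divisibility using (_∣_; ∣-trans)
open import Data.Nat.DivMod using (m/n*n≡m)
open import Data.Nat.LCM using (lcm; m∣lcm[m,n]; n∣lcm[m,n])
open import Data.Nat.ListAction using (sum)
open import Data.Nat.ListAction.Properties using (sum-++)
import Data.Nat.Properties as ℕ
open import Data.Nat.Solver using (module +-*-Solver)
open import Data.Product using (∃-syntax; Σ-syntax; _×_; _,_; proj₁; proj₂)
open import Data.Rational.Base as ℚ using (ℚ)
import Data.Rational.Properties as ℚ
open import Data.Rational.Unnormalised.Base as ℚᵘ using (mkℚᵘ; *≡*; *≤*)
import Data.Rational.Unnormalised.Properties as ℚᵘ
open import Data.Vec.Functional using (Vector)
open import Function.Base using (_∘_; id)
open import Function.Bundles using (_⇔_; Inverse; Injection; mk⇔)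
open import Function.Properties.Inverse using (Inverse⇒Injection; ↔-refl; ↔-sym)
open import Level using (0ℓ)
open import Relation.Binary.Bundles using (DecSetoid)
open import Relation.Binary.PropositionalEquality using (_≡_; _≢_; refl; sym; trans; cong; cong₂;
  subst; subst₂; module ≡-Reasoning)
open import Relation.Nullary using (Dec; yes; no; does; ¬_; contradiction)
open import Relation.Nullary.Decidable using (¬?; _×-dec_; via-injection)
open import Relation.Unary using (Pred; Decidable)
import Algebra.Properties.Semiring.Sum (CommutativeRing.semiring ℚ.+-*-commutativeRing) as ℚSum

-- The weights match for this reason: a winning `g` from the source of block `j` contributes 1/(m
-- k_j) to ρ_Δ, while u - g with `g` in block `j` occurs k̃/k_j times among the external
-- differences. The repetition therefore sits on the block of the encoded element. The game counts
-- elements `g`, whereas the multiplicity counts pairs (u , g). The two counts agree because the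
-- other blocks are disjoint and free of repetitions, so at most one `u` equals g + Δ. In (I) the
-- tuple K, and with it the factor k̃ m, is fixed, so minimising λ and minimising ρ are the same
-- task. In (II) K varies and the values λ of different tuples are not comparable; the comparison
-- takes place on λ/(k̃ m), which is ρ itself. Two technical constraints shape the development:
-- rational identities are proved by clearing denominators until both sides come from natural
-- numbers, and group equality is a mere equivalence relation, so sums over the group run over
-- enumerated representatives.

private
  variable
    A B : Set
    m n : ℕ

-- Finite sums over lists

∑ : List A → (A → ℕ) → ℕ
∑ xs f = sum (map f xs)

infix 5 ∑
syntax ∑ xs (λ x → e) = ∑[ x ← xs ] e

∑-cong : ∀ (xs : List A) {f g} → (∀ x → f x ≡ g x) → ∑ xs f ≡ ∑ xs g
∑-cong xs f≗g = cong sum (List.map-cong f≗g xs)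

∑-cong-∈ : ∀ (xs : List A) {f g : A → ℕ} → (∀ {x} → x ∈ₚ xs → f x ≡ g x) → ∑ xs f ≡ ∑ xs g
∑-cong-∈ []       f≗g = refl
∑-cong-∈ (x ∷ xs) f≗g = cong₂ _+_ (f≗g (here refl)) (∑-cong-∈ xs (f≗g ∘ there))

∑-mono : ∀ (xs : List A) {f g : A → ℕ} → (∀ x → f x ≤ g x) → ∑ xs f ≤ ∑ xs g
∑-mono []       f≤g = z≤n
∑-mono (x ∷ xs) f≤g = ℕ.+-mono-≤ (f≤g x) (∑-mono xs f≤g)

∑-+ : ∀ (xs : List A) {f g : A → ℕ} → ∑ xs f + ∑ xs g ≡ ∑[ x ← xs ] (f x + g x)
∑-+ []               = refl
∑-+ (x ∷ xs) {f} {g} = trans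
  (solve 4 (λ a b c d → (a :+ b) :+ (c :+ d) := (a :+ c) :+ (b :+ d)) refl (f x) (∑ xs f) (g x) (∑ xs g))
  (cong₂ _+_ refl (∑-+ xs))
  where open +-*-Solver using (solve; _:+_; _:=_)

∑-zero : ∀ (xs : List A) → ∑[ x ← xs ] 0 ≡ 0
∑-zero []       = refl
∑-zero (x ∷ xs) = ∑-zero xs

∑-*ˡ : ∀ c (xs : List A) {f : A → ℕ} → c * ∑ xs f ≡ ∑[ x ← xs ] (c * f x)
∑-*ˡ c []           = ℕ.*-zeroʳ c
∑-*ˡ c (x ∷ xs) {f} = trans (ℕ.*-distribˡ-+ c (f x) (∑ xs f)) (cong₂ _+_ refl (∑-*ˡ c xs))

∑-const : ∀ c (xs : List A) → ∑[ x ← xs ] c ≡ length xs * c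
∑-const c []       = refl
∑-const c (x ∷ xs) = cong₂ _+_ refl (∑-const c xs)

∑-one : ∀ (xs : List A) → ∑[ x ← xs ] 1 ≡ length xs
∑-one xs = trans (∑-const 1 xs) (ℕ.*-identityʳ _)

∑-swap : ∀ (xs : List A) (ys : List B) {f : A → B → ℕ} →
         (∑[ x ← xs ] ∑[ y ← ys ] f x y) ≡ (∑[ y ← ys ] ∑[ x ← xs ] f x y)
∑-swap []       ys     = sym (∑-zero ys)
∑-swap (x ∷ xs) ys {f} = trans (cong₂ _+_ refl (∑-swap xs ys)) (∑-+ ys)

∑-++ : ∀ (xs ys : List A) {f : A → ℕ} → ∑ (xs ++ ys) f ≡ ∑ xs f + ∑ ys f
∑-++ xs ys {f} = trans (cong sum (List.map-++ f xs ys)) (sum-++ (map f xs) (map f ys))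

∑-map : ∀ (h : A → B) (xs : List A) {f : B → ℕ} → ∑ (map h xs) f ≡ ∑[ x ← xs ] f (h x)
∑-map h xs = cong sum (sym (List.map-∘ xs))

∑-concatMap : ∀ (h : A → List B) (xs : List A) {f : B → ℕ} →
              ∑ (concatMap h xs) f ≡ ∑[ x ← xs ] ∑ (h x) f
∑-concatMap h []           = refl
∑-concatMap h (x ∷ xs) {f} =
  trans (∑-++ (h x) (concatMap h xs)) (cong₂ _+_ refl (∑-concatMap h xs))

∑-replicate : ∀ k (x : A) {f : A → ℕ} → ∑ (replicate k x) f ≡ k * f x
∑-replicate zero    x     = refl
∑-replicate (suc k) x {f} = cong₂ _+_ refl (∑-replicate k x)

∑-cartesianProductWith : ∀ {C : Set} (h : A → B → C) (xs : List A) (ys : List B) {f : C → ℕ} →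
  ∑ (cartesianProductWith h xs ys) f ≡ ∑[ x ← xs ] ∑[ y ← ys ] f (h x y)
∑-cartesianProductWith h []       ys     = refl
∑-cartesianProductWith h (x ∷ xs) ys {f} = trans (∑-++ (map (h x) ys) _)
  (cong₂ _+_ (∑-map (h x) ys) (∑-cartesianProductWith h xs ys))

-- Slack at one summand could not be made up elsewhere, since every other summand is bounded too;
-- cancelling the rest of the sum isolates the summand in question.
∑-mono-tight : ∀ (xs : List A) {f g : A → ℕ} → (∀ x → f x ≤ g x) →
               ∑ xs g ≤ ∑ xs f → ∀ {x} → x ∈ₚ xs → f x ≡ g x
∑-mono-tight (x ∷ xs) {f} {g} f≤g ∑g≤∑f (here refl) = ℕ.≤-antisym (f≤g x)
  (ℕ.+-cancelʳ-≤ (∑ xs g) (g x) (f x) (ℕ.≤-trans ∑g≤∑f (ℕ.+-monoʳ-≤ (f x) (∑-mono xs f≤g))))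
∑-mono-tight (x ∷ xs) {f} {g} f≤g ∑g≤∑f (there y∈xs) = ∑-mono-tight xs f≤g
  (ℕ.+-cancelˡ-≤ (g x) _ _ (ℕ.≤-trans ∑g≤∑f (ℕ.+-monoˡ-≤ (∑ xs f) (f≤g x)))) y∈xs

∑-positive : ∀ (xs : List A) (f : A → ℕ) → ∑ xs f ≢ 0 → ∃[ x ] f x ≢ 0
∑-positive []       f ∑≢0 = contradiction refl ∑≢0
∑-positive (x ∷ xs) f ∑≢0 with f x in eq
... | zero  = ∑-positive xs f ∑≢0
... | suc _ = x , λ fx≡0 → ℕ.1+n≢0 (trans (sym eq) fx≡0)

length-allFin : ∀ m → length (allFin m) ≡ m
length-allFin m = List.length-tabulate id

sumℕ≡∑ : ∀ (f : Vector ℕ m) → sumℕ f ≡ ∑ (allFin m) f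
sumℕ≡∑ f = trans (go f) (cong sum (sym (List.map-tabulate id f)))
  where
  go : ∀ {m} (f : Vector ℕ m) → sumℕ f ≡ sum (tabulate f)
  go {zero}  f = refl
  go {suc m} f = cong₂ _+_ refl (go (f ∘ Fin.suc))

sumℕ-cong : ∀ {f g : Vector ℕ m} → (∀ i → f i ≡ g i) → sumℕ f ≡ sumℕ g
sumℕ-cong {m} {f} {g} f≗g = trans (sumℕ≡∑ f) (trans (∑-cong (allFin m) f≗g) (sym (sumℕ≡∑ g)))

-- Indicators

-- The Iverson bracket. It computes on `does`, as `filter` does, so a single case split reduces
-- both.
⟦_⟧ : {P : Set} → Dec P → ℕ
⟦ d ⟧ = if does d then 1 else 0

⟦⟧-true : ∀ {P : Set} (d : Dec P) → P → ⟦ d ⟧ ≡ 1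
⟦⟧-true (yes _) _ = refl
⟦⟧-true (no ¬p) p = contradiction p ¬p

⟦⟧-false : ∀ {P : Set} (d : Dec P) → ¬ P → ⟦ d ⟧ ≡ 0
⟦⟧-false (yes p) ¬p = contradiction p ¬p
⟦⟧-false (no _)  _  = refl

⟦⟧-cong : ∀ {P Q : Set} (d : Dec P) (e : Dec Q) → (P → Q) → (Q → P) → ⟦ d ⟧ ≡ ⟦ e ⟧
⟦⟧-cong (yes p) e P→Q Q→P = sym (⟦⟧-true e (P→Q p))
⟦⟧-cong (no ¬p) e P→Q Q→P = sym (⟦⟧-false e (¬p ∘ Q→P))

⟦⟧-¬ : ∀ {P : Set} (d : Dec P) → ⟦ d ⟧ + ⟦ ¬? d ⟧ ≡ 1
⟦⟧-¬ (yes _) = refl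
⟦⟧-¬ (no _)  = refl

module _ {A : Set} {P : Pred A 0ℓ} (P? : Decidable P) where

  ∑-filter : ∀ xs {f : A → ℕ} → ∑ (filter P? xs) f ≡ ∑[ x ← xs ] (⟦ P? x ⟧ * f x)
  ∑-filter []           = refl
  ∑-filter (x ∷ xs) {f} with does (P? x)
  ... | true  = cong₂ _+_ (sym (ℕ.*-identityˡ (f x))) (∑-filter xs)
  ... | false = ∑-filter xs

  length-filter≡∑ : ∀ xs → length (filter P? xs) ≡ ∑[ x ← xs ] ⟦ P? x ⟧
  length-filter≡∑ []       = refl
  length-filter≡∑ (x ∷ xs) with does (P? x)
  ... | true  = cong suc (length-filter≡∑ xs)
  ... | false = length-filter≡∑ xs

⟦⟧-*-zero : ∀ {P : Set} (d : Dec P) {i} → (P → i ≡ 0) → ⟦ d ⟧ * i ≡ 0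
⟦⟧-*-zero (yes p) {i} P⇒i≡0 = trans (ℕ.*-identityˡ i) (P⇒i≡0 p)
⟦⟧-*-zero (no _)      P⇒i≡0 = refl

*-⟦⟧-cong : ∀ {P : Set} (d : Dec P) {i j} → (P → i ≡ j) → i * ⟦ d ⟧ ≡ j * ⟦ d ⟧
*-⟦⟧-cong (yes p)         P⇒i≡j = cong (_* 1) (P⇒i≡j p)
*-⟦⟧-cong (no _)  {i} {j} P⇒i≡j = trans (ℕ.*-zeroʳ i) (sym (ℕ.*-zeroʳ j))

≤-*-⟦¬⟧ : ∀ {P : Set} (d : Dec P) {i j} → (P → i ≡ 0) → (¬ P → i ≤ j) → i ≤ j * ⟦ ¬? d ⟧
≤-*-⟦¬⟧ (yes p) {i} {j} P⇒i≡0 _ = ℕ.≤-reflexive (trans (P⇒i≡0 p) (sym (ℕ.*-zeroʳ j)))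
≤-*-⟦¬⟧ (no ¬p) {i} {j} _ ¬P⇒i≤j = ℕ.≤-trans (¬P⇒i≤j ¬p) (ℕ.≤-reflexive (sym (ℕ.*-identityʳ j)))

⟦⟧≤1 : ∀ {P : Set} (d : Dec P) → ⟦ d ⟧ ≤ 1
⟦⟧≤1 (yes _) = ℕ.≤-refl
⟦⟧≤1 (no _)  = z≤n

module _ (S : DecSetoid 0ℓ 0ℓ) where
  open DecSetoid S using (_≟_; setoid)
  open DecMembership S using (_∈_; _∈?_)

  -- Without repetitions there are zero or one matches, so counting matches decides membership. The
  -- decision is an argument so that known membership can be supplied as `yes`.
  ∑-indicator : ∀ {xs} → Setoid.Unique setoid xs → ∀ y (y∈? : Dec (y ∈ xs)) →
                ∑[ x ← xs ] ⟦ y ≟ x ⟧ ≡ ⟦ y∈? ⟧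
  ∑-indicator []                     y y∈? = sym (⟦⟧-false y∈? λ ())
  ∑-indicator (_∷_ {x} {xs} x# xs!) y y∈? with y ≟ x
  ... | yes y≈x = trans (cong suc (∑-indicator xs! y (no y∉xs))) (sym (⟦⟧-true y∈? (here y≈x)))
    where
    y∉xs : ¬ y ∈ xs
    -- `y` equals the head `x`, so a second occurrence in the tail would repeat `x`.
    y∉xs y∈xs = All.All¬⇒¬Any x# (SetoidMembership.∈-resp-≈ setoid y≈x y∈xs)
  ... | no y≉x = trans (∑-indicator xs! y (y ∈? xs))
    (⟦⟧-cong (y ∈? xs) y∈? there λ { (here y≈x) → contradiction y≈x y≉x ; (there y∈xs) → y∈xs })

∑-allFin-indicator : ∀ (j : Fin m) → ∑[ i ← allFin m ] ⟦ j Fin.≟ i ⟧ ≡ 1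
∑-allFin-indicator {m} j = ∑-indicator (Fin.≡-decSetoid m) (Unique.allFin⁺ m) j (yes (∈-allFin j))

∑-allFin-≢ : ∀ (j : Fin m) → ∑[ i ← allFin m ] ⟦ ¬? (j Fin.≟ i) ⟧ ≡ m ∸ 1
-- The leading 1 stands for the index `j` itself; together with it all `m` indices are counted.
∑-allFin-≢ {m} j = cong (_∸ 1) (begin
  1 + (∑[ i ← allFin m ] ⟦ ¬? (j Fin.≟ i) ⟧)                                    ≡⟨ cong₂ _+_ (∑-allFin-indicator j) refl ⟨
  (∑[ i ← allFin m ] ⟦ j Fin.≟ i ⟧) + (∑[ i ← allFin m ] ⟦ ¬? (j Fin.≟ i) ⟧)  ≡⟨ ∑-+ (allFin m) ⟩
  ∑[ i ← allFin m ] (⟦ j Fin.≟ i ⟧ + ⟦ ¬? (j Fin.≟ i) ⟧)                       ≡⟨ ∑-cong (allFin m) (λ i → ⟦⟧-¬ (j Fin.≟ i)) ⟩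
  ∑[ i ← allFin m ] 1                                                            ≡⟨ ∑-one (allFin m) ⟩
  length (allFin m)                                                              ≡⟨ length-allFin m ⟩
  m                                                                              ∎)
  where open ≡-Reasoning

-- Rationals

toℚᵘ-/ : ∀ p q .{{_ : NonZero q}} → ℚ.toℚᵘ (+ p ℚ./ q) ℚᵘ.≃ + p ℚᵘ./ q
toℚᵘ-/ p (suc q) = ℚ.toℚᵘ-fromℚᵘ (mkℚᵘ (+ p) q)

fromℕ-+ : ∀ i j → fromℕ (i + j) ≡ fromℕ i ℚ.+ fromℕ j
fromℕ-+ i j = ℚ.toℚᵘ-injective (begin
  ℚ.toℚᵘ (fromℕ (i + j))                   ≈⟨ toℚᵘ-/ (i + j) 1 ⟩
  + (i + j) ℚᵘ./ 1                         ≈⟨ *≡* (cong (ℤ._* + 1) (sym (cong₂ ℤ._+_ (ℤ.*-identityʳ (+ i)) (ℤ.*-identityʳ (+ j))))) ⟩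
  + i ℚᵘ./ 1 ℚᵘ.+ + j ℚᵘ./ 1               ≈⟨ ℚᵘ.+-cong (toℚᵘ-/ i 1) (toℚᵘ-/ j 1) ⟨
  ℚ.toℚᵘ (fromℕ i) ℚᵘ.+ ℚ.toℚᵘ (fromℕ j)  ≈⟨ ℚ.toℚᵘ-homo-+ (fromℕ i) (fromℕ j) ⟨
  ℚ.toℚᵘ (fromℕ i ℚ.+ fromℕ j)             ∎)
  where open ℚᵘ.≃-Reasoning

fromℕ-* : ∀ i j → fromℕ (i * j) ≡ fromℕ i ℚ.* fromℕ j
fromℕ-* i j = ℚ.toℚᵘ-injective (begin
  ℚ.toℚᵘ (fromℕ (i * j))                   ≈⟨ toℚᵘ-/ (i * j) 1 ⟩
  + (i * j) ℚᵘ./ 1                         ≈⟨ *≡* (cong (ℤ._* + 1) (ℤ.pos-* i j)) ⟩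
  (+ i ℚᵘ./ 1) ℚᵘ.* (+ j ℚᵘ./ 1)           ≈⟨ ℚᵘ.*-cong (toℚᵘ-/ i 1) (toℚᵘ-/ j 1) ⟨
  ℚ.toℚᵘ (fromℕ i) ℚᵘ.* ℚ.toℚᵘ (fromℕ j)  ≈⟨ ℚ.toℚᵘ-homo-* (fromℕ i) (fromℕ j) ⟨
  ℚ.toℚᵘ (fromℕ i ℚ.* fromℕ j)             ∎)
  where open ℚᵘ.≃-Reasoning

-- Clears a denominator. The factors 1/m and 1/k_j of the winning probability, `normalised` and
-- `patersonStinson` are all handled through this equation.
fromℕ-*-/ : ∀ p q .{{_ : NonZero q}} → fromℕ q ℚ.* (+ p ℚ./ q) ≡ fromℕ p
fromℕ-*-/ p q@(suc _) = ℚ.toℚᵘ-injective (begin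
  ℚ.toℚᵘ (fromℕ q ℚ.* (+ p ℚ./ q))             ≈⟨ ℚ.toℚᵘ-homo-* (fromℕ q) (+ p ℚ./ q) ⟩
  ℚ.toℚᵘ (fromℕ q) ℚᵘ.* ℚ.toℚᵘ (+ p ℚ./ q)    ≈⟨ ℚᵘ.*-cong (toℚᵘ-/ q 1) (toℚᵘ-/ p q) ⟩
  (+ q ℚᵘ./ 1) ℚᵘ.* (+ p ℚᵘ./ q)               ≈⟨ *≡* cross ⟩
  + p ℚᵘ./ 1                                   ≈⟨ toℚᵘ-/ p 1 ⟨
  ℚ.toℚᵘ (fromℕ p)                             ∎)
  where
  open ℚᵘ.≃-Reasoning
  cross : (+ q ℤ.* + p) ℤ.* + 1 ≡ + p ℤ.* + (1 * q)
  cross = trans (ℤ.*-identityʳ (+ q ℤ.* + p))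
    (trans (ℤ.*-comm (+ q) (+ p)) (cong (λ z → + p ℤ.* + z) (sym (ℕ.*-identityˡ q))))

fromℕ-mono-≤ : ∀ {i j} → i ≤ j → fromℕ i ℚ.≤ fromℕ j
fromℕ-mono-≤ {i} {j} i≤j = ℚ.toℚᵘ-cancel-≤ (begin
  ℚ.toℚᵘ (fromℕ i)  ≃⟨ toℚᵘ-/ i 1 ⟩
  + i ℚᵘ./ 1        ≤⟨ *≤* (ℤ.*-monoʳ-≤-nonNeg (+ 1) (ℤ.+≤+ i≤j)) ⟩
  + j ℚᵘ./ 1        ≃⟨ toℚᵘ-/ j 1 ⟨
  ℚ.toℚᵘ (fromℕ j)  ∎)
  where open ℚᵘ.≤-Reasoning

fromℕ-cancel-≤ : ∀ {i j} → fromℕ i ℚ.≤ fromℕ j → i ≤ j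
fromℕ-cancel-≤ {i} {j} i≤j = ℤ.drop‿+≤+ (ℤ.*-cancelʳ-≤-pos (+ i) (+ j) (+ 1) (ℚᵘ.drop-*≤* (begin
  + i ℚᵘ./ 1        ≃⟨ toℚᵘ-/ i 1 ⟨
  ℚ.toℚᵘ (fromℕ i)  ≤⟨ ℚ.toℚᵘ-mono-≤ i≤j ⟩
  ℚ.toℚᵘ (fromℕ j)  ≃⟨ toℚᵘ-/ j 1 ⟩
  + j ℚᵘ./ 1        ∎)))
  where open ℚᵘ.≤-Reasoning

fromℕ-injective : ∀ {i j} → fromℕ i ≡ fromℕ j → i ≡ j
fromℕ-injective eq = ℕ.≤-antisym (fromℕ-cancel-≤ (ℚ.≤-reflexive eq)) (fromℕ-cancel-≤ (ℚ.≤-reflexive (sym eq)))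

fromℕ-sum : ∀ (f : Vector ℕ m) → sumℚ (fromℕ ∘ f) ≡ fromℕ (sumℕ f)
fromℕ-sum {zero}  f = refl
fromℕ-sum {suc m} f = trans (cong (fromℕ (f Fin.zero) ℚ.+_) (fromℕ-sum (f ∘ Fin.suc)))
  (sym (fromℕ-+ (f Fin.zero) _))

module _ (q : ℕ) .{{_ : NonZero q}} where

  private instance
    q-positive : ℚ.Positive (fromℕ q)
    q-positive = ℚ.normalize-pos q 1

    q-nonNegative : ℚ.NonNegative (fromℕ q)
    q-nonNegative = ℚ.pos⇒nonNeg (fromℕ q)

  fromℕ-*-cancelˡ-≤ : ∀ {x y} → fromℕ q ℚ.* x ℚ.≤ fromℕ q ℚ.* y → x ℚ.≤ y
  fromℕ-*-cancelˡ-≤ = ℚ.*-cancelˡ-≤-pos (fromℕ q)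

  fromℕ-*-monoʳ-≤ : ∀ {x y} → x ℚ.≤ y → fromℕ q ℚ.* x ℚ.≤ fromℕ q ℚ.* y
  fromℕ-*-monoʳ-≤ = ℚ.*-monoˡ-≤-nonNeg (fromℕ q)

  fromℕ-*-cancelˡ : ∀ {x y} → fromℕ q ℚ.* x ≡ fromℕ q ℚ.* y → x ≡ y
  fromℕ-*-cancelˡ eq = ℚ.≤-antisym (fromℕ-*-cancelˡ-≤ (ℚ.≤-reflexive eq))
    (fromℕ-*-cancelˡ-≤ (ℚ.≤-reflexive (sym eq)))

  -- With q = k̃ m, this and its converse `unscale-≤` carry inequalities between values of λ to
  -- inequalities between values of ρ and back.
  scale-≤ : ∀ {i j x y} → fromℕ i ≡ fromℕ q ℚ.* x → fromℕ j ≡ fromℕ q ℚ.* y → i ≤ j → x ℚ.≤ y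
  scale-≤ i≡ j≡ i≤j = fromℕ-*-cancelˡ-≤ (subst₂ ℚ._≤_ i≡ j≡ (fromℕ-mono-≤ i≤j))

  unscale-≤ : ∀ {i j x y} → fromℕ i ≡ fromℕ q ℚ.* x → fromℕ j ≡ fromℕ q ℚ.* y → x ℚ.≤ y → i ≤ j
  unscale-≤ i≡ j≡ x≤y = fromℕ-cancel-≤ (subst₂ ℚ._≤_ (sym i≡) (sym j≡) (fromℕ-*-monoʳ-≤ x≤y))

-- Least common multiples and normalised parameters

lcms-cong : ∀ {k k′ : Vector ℕ m} → (∀ i → k i ≡ k′ i) → lcms k ≡ lcms k′
lcms-cong {zero}  k≗k′ = refl
lcms-cong {suc m} k≗k′ = cong₂ lcm (k≗k′ Fin.zero) (lcms-cong (k≗k′ ∘ Fin.suc))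

∣lcms : ∀ (k : Vector ℕ m) i → k i ∣ lcms k
∣lcms k Fin.zero    = m∣lcm[m,n] _ _
∣lcms k (Fin.suc i) = ∣-trans (∣lcms (k ∘ Fin.suc) i) (n∣lcm[m,n] (k Fin.zero) _)

k̃*m≢0 : ∀ (K : Sizes m) .{{_ : NonZero m}} → NonZero (k̃ K * m)
k̃*m≢0 {m} K = ℕ.m*n≢0 (k̃ K) m {{lcms-nonZero m (size K) (positive K)}}

normalised-scaled : ∀ (K : Sizes m) .{{_ : NonZero m}} l → fromℕ l ≡ fromℕ (k̃ K * m) ℚ.* normalised m K l
normalised-scaled {m} K l = sym (fromℕ-*-/ l (k̃ K * m) {{k̃*m≢0 K}})

normalised-unique : ∀ (K : Sizes m) .{{_ : NonZero m}} l {ρ} → fromℕ l ≡ fromℕ (k̃ K * m) ℚ.* ρ → ρ ≡ normalised m K l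
normalised-unique {m} K l l≡ = fromℕ-*-cancelˡ (k̃ K * m) {{k̃*m≢0 K}} (trans (sym l≡) (normalised-scaled K l))

-- Multi-sets of group elements

module _ {n : ℕ} (G : FiniteAbelianGroup n) where
  open FiniteAbelianGroup G renaming (sym to ≈-sym; trans to ≈-trans; refl to ≈-refl)
  private module E = Inverse enumeration

  elements : List Carrier
  elements = map E.to (allFin n)

  elements-unique : Unique elements
  elements-unique = SetoidUnique.map⁺ (Fin.≡-setoid n) setoid
    (Injection.injective (Inverse⇒Injection enumeration)) (Unique.allFin⁺ n)

  -- The tightness argument for sums needs membership up to `_≡_`, which only the enumerated
  -- representative of `x` is sure to have.
  to∘from∈elements : ∀ x → E.to (E.from x) ∈ₚ elements
  to∘from∈elements x = ∈-map⁺ E.to (∈-allFin (E.from x))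

  x≈to∘from : ∀ x → x ≈ E.to (E.from x)
  x≈to∘from x = ≈-sym (E.strictlyInverseˡ x)

  ∈-elements : ∀ x → x ∈ elements
  ∈-elements x = Any.map (λ { refl → x≈to∘from x }) (to∘from∈elements x)

  ∑-elements-indicator : ∀ x → ∑[ e ← elements ] ⟦ x ≟ e ⟧ ≡ 1
  ∑-elements-indicator x = ∑-indicator decSetoid elements-unique x (yes (∈-elements x))

  length-elements : length elements ≡ n
  length-elements = trans (List.length-map E.to (allFin n)) (length-allFin n)

  multiplicity≡∑ : ∀ x B → multiplicity x B ≡ ∑[ b ← B ] ⟦ x ≟ b ⟧
  multiplicity≡∑ x B = length-filter≡∑ (x ≟_) B

  multiplicity-cong : ∀ {x y} B → x ≈ y → multiplicity x B ≡ multiplicity y B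
  multiplicity-cong {x} {y} B x≈y = begin
    multiplicity x B       ≡⟨ multiplicity≡∑ x B ⟩
    ∑[ b ← B ] ⟦ x ≟ b ⟧  ≡⟨ ∑-cong B (λ b → ⟦⟧-cong (x ≟ b) (y ≟ b) (≈-trans (≈-sym x≈y)) (≈-trans x≈y)) ⟩
    ∑[ b ← B ] ⟦ y ≟ b ⟧  ≡⟨ multiplicity≡∑ y B ⟨
    multiplicity y B       ∎
    where open ≡-Reasoning

  -- Double counting: each entry of `B` equals exactly one enumerated element.
  ∑-multiplicity : ∀ B → ∑[ x ← elements ] multiplicity x B ≡ length B
  ∑-multiplicity B = begin
    ∑[ x ← elements ] multiplicity x B          ≡⟨ ∑-cong elements (λ x → multiplicity≡∑ x B) ⟩
    ∑[ x ← elements ] ∑[ b ← B ] ⟦ x ≟ b ⟧     ≡⟨ ∑-swap elements B ⟩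
    ∑[ b ← B ] ∑[ x ← elements ] ⟦ x ≟ b ⟧     ≡⟨ ∑-cong B (λ b → ∑-cong elements (λ x → ⟦⟧-cong (x ≟ b) (b ≟ x) ≈-sym ≈-sym)) ⟩
    ∑[ b ← B ] ∑[ x ← elements ] ⟦ b ≟ x ⟧     ≡⟨ ∑-cong B ∑-elements-indicator ⟩
    ∑[ b ← B ] 1                                ≡⟨ ∑-one B ⟩
    length B                                    ∎
    where open ≡-Reasoning

  ∑-⊠ : ∀ k B {f : Carrier → ℕ} → ∑ (k ⊠ B) f ≡ k * ∑ B f
  ∑-⊠ k B {f} = begin
    ∑ (k ⊠ B) f                             ≡⟨ ∑-concatMap (replicate k) B ⟩
    ∑[ b ← B ] ∑ (replicate k b) f          ≡⟨ ∑-cong B (λ b → ∑-replicate k b) ⟩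
    ∑[ b ← B ] (k * f b)                    ≡⟨ ∑-*ˡ k B ⟨
    k * ∑ B f                               ∎
    where open ≡-Reasoning

  length-⊠ : ∀ k B → length (k ⊠ B) ≡ k * length B
  length-⊠ k B = trans (sym (∑-one (k ⊠ B))) (trans (∑-⊠ k B) (cong (k *_) (∑-one B)))

  multiplicity-⊠ : ∀ x k B → multiplicity x (k ⊠ B) ≡ k * multiplicity x B
  multiplicity-⊠ x k B = trans (multiplicity≡∑ x (k ⊠ B))
    (trans (∑-⊠ k B) (cong (k *_) (sym (multiplicity≡∑ x B))))

  multiplicity-G∖0 : ∀ x → multiplicity x G∖0 ≡ ⟦ ¬? (x ≟ 𝟘) ⟧
  multiplicity-G∖0 x = begin
    multiplicity x G∖0                                        ≡⟨ multiplicity≡∑ x G∖0 ⟩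
    ∑[ e ← G∖0 ] ⟦ x ≟ e ⟧                                    ≡⟨ ∑-filter (λ e → ¬? (e ≟ 𝟘)) elements ⟩
    ∑[ e ← elements ] (⟦ ¬? (e ≟ 𝟘) ⟧ * ⟦ x ≟ e ⟧)           ≡⟨ ∑-cong elements step ⟩
    ∑[ e ← elements ] (⟦ ¬? (x ≟ 𝟘) ⟧ * ⟦ x ≟ e ⟧)           ≡⟨ ∑-*ˡ ⟦ ¬? (x ≟ 𝟘) ⟧ elements ⟨
    ⟦ ¬? (x ≟ 𝟘) ⟧ * (∑[ e ← elements ] ⟦ x ≟ e ⟧)           ≡⟨ cong (⟦ ¬? (x ≟ 𝟘) ⟧ *_) (∑-elements-indicator x) ⟩
    ⟦ ¬? (x ≟ 𝟘) ⟧ * 1                                        ≡⟨ ℕ.*-identityʳ _ ⟩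
    ⟦ ¬? (x ≟ 𝟘) ⟧                                            ∎
    where
    open ≡-Reasoning
    step : ∀ e → ⟦ ¬? (e ≟ 𝟘) ⟧ * ⟦ x ≟ e ⟧ ≡ ⟦ ¬? (x ≟ 𝟘) ⟧ * ⟦ x ≟ e ⟧
    -- The factor `⟦ x ≟ e ⟧` vanishes unless `e` equals `x`, so the test against zero may be moved
    -- from `e` to `x` and taken out of the sum.
    step e = *-⟦⟧-cong (x ≟ e) λ x≈e → ⟦⟧-cong (¬? (e ≟ 𝟘)) (¬? (x ≟ 𝟘))
      (λ e≉0 x≈0 → e≉0 (≈-trans (≈-sym x≈e) x≈0)) (λ x≉0 e≈0 → x≉0 (≈-trans x≈e e≈0))

  length-G∖0 : length G∖0 ≡ n ∸ 1
  length-G∖0 = cong (_∸ 1) (begin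
    1 + length G∖0
      ≡⟨ cong₂ _+_ (sym (∑-elements-indicator 𝟘)) (length-filter≡∑ (λ e → ¬? (e ≟ 𝟘)) elements) ⟩
    (∑[ e ← elements ] ⟦ 𝟘 ≟ e ⟧) + (∑[ e ← elements ] ⟦ ¬? (e ≟ 𝟘) ⟧)
      ≡⟨ ∑-+ elements ⟩
    ∑[ e ← elements ] (⟦ 𝟘 ≟ e ⟧ + ⟦ ¬? (e ≟ 𝟘) ⟧)
      ≡⟨ ∑-cong elements (λ e → trans (cong₂ _+_ (⟦⟧-cong (𝟘 ≟ e) (e ≟ 𝟘) ≈-sym ≈-sym) refl) (⟦⟧-¬ (e ≟ 𝟘))) ⟩
    ∑[ e ← elements ] 1
      ≡⟨ ∑-one elements ⟩
    length elements
      ≡⟨ length-elements ⟩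
    n
      ∎)
    where open ≡-Reasoning

  -- Lengths are sums of multiplicities over the group, so a containment that loses no length is
  -- tight at every element.
  length-tight⇒≈ₘ : ∀ B C → B ⊆ₘ C → length C ≤ length B → B ≈ₘ C
  length-tight⇒≈ₘ B C B⊆C |C|≤|B| x = begin
    multiplicity x B                   ≡⟨ multiplicity-cong B (x≈to∘from x) ⟩
    multiplicity (E.to (E.from x)) B   ≡⟨ ∑-mono-tight elements B⊆C
                                            (subst₂ _≤_ (sym (∑-multiplicity C)) (sym (∑-multiplicity B)) |C|≤|B|)
                                            (to∘from∈elements x) ⟩
    multiplicity (E.to (E.from x)) C   ≡⟨ multiplicity-cong C (x≈to∘from x) ⟨
    multiplicity x C                   ∎
    where open ≡-Reasoning

  -- The right-hand multi-set has multiplicity `l` away from zero and 0 at zero, which is why zero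
  -- gets a condition of its own.
  ⊆ₘ-⊠G∖0 : ∀ B {l} → multiplicity 𝟘 B ≡ 0 → (∀ x → x ≉ 𝟘 → multiplicity x B ≤ l) → B ⊆ₘ l ⊠ G∖0
  ⊆ₘ-⊠G∖0 B {l} mult0≡0 mult≤l x = subst (multiplicity x B ≤_)
    (sym (trans (multiplicity-⊠ x l G∖0) (cong (l *_) (multiplicity-G∖0 x)))) bound
    where
    bound : multiplicity x B ≤ l * ⟦ ¬? (x ≟ 𝟘) ⟧
    bound = ≤-*-⟦¬⟧ (x ≟ 𝟘) (λ x≈0 → trans (multiplicity-cong B x≈0) mult0≡0) (mult≤l x)

  ⊠G∖0-bound : ∀ B l → B ⊆ₘ l ⊠ G∖0 → ∀ x → multiplicity x B ≤ l
  ⊠G∖0-bound B l B⊆ x = begin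
    multiplicity x B              ≤⟨ B⊆ x ⟩
    multiplicity x (l ⊠ G∖0)      ≡⟨ multiplicity-⊠ x l G∖0 ⟩
    l * multiplicity x G∖0        ≡⟨ cong (l *_) (multiplicity-G∖0 x) ⟩
    l * ⟦ ¬? (x ≟ 𝟘) ⟧            ≤⟨ ℕ.*-monoʳ-≤ l (⟦⟧≤1 (¬? (x ≟ 𝟘))) ⟩
    l * 1                         ≡⟨ ℕ.*-identityʳ l ⟩
    l                             ∎
    where
    open ℕ.≤-Reasoning

-- External differences

module _ {n m : ℕ} {G : FiniteAbelianGroup n} (𝓑 : DisjointFamily G (Fin m)) where
  open FiniteAbelianGroup G renaming (sym to ≈-sym; trans to ≈-trans; refl to ≈-refl)
  open DisjointFamily 𝓑
  open import Algebra.Properties.Group group using (//-rightDividesˡ; //-rightDividesʳ)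

  weight : Fin m → ℕ
  weight j = (k̃ (sizes 𝓑) ℕ./ card j) {{nonempty j}}

  -- The division defining the weight is exact, as each block size divides the least common
  -- multiple.
  weight*card : ∀ j → weight j * card j ≡ k̃ (sizes 𝓑)
  weight*card j = m/n*n≡m {{nonempty j}} (∣lcms card j)

  -- Stated for arbitrary `h` to serve two counts: the constant 1 gives the number of differences,
  -- the indicator of Δ its multiplicity. The sum over `j` is outermost because the weight depends
  -- on `j` alone.
  ∑-externalDifferences : ∀ (h : Carrier → ℕ) → ∑ (externalDifferences 𝓑) h ≡
    (∑[ j ← allFin m ] (weight j *
      (∑[ i ← allFin m ] (⟦ ¬? (i Fin.≟ j) ⟧ * (∑[ u ← block i ] ∑[ g ← block j ] h (u ⊖ g))))))
  ∑-externalDifferences h = begin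
    ∑ (externalDifferences 𝓑) h
      ≡⟨ ∑-concatMap _ (filter _ pairs) ⟩
    ∑[ p ← filter (λ (i , j) → ¬? (i Fin.≟ j)) pairs ] ∑ (D (block (proj₁ p)) (B̃ 𝓑 (proj₂ p))) h
      ≡⟨ ∑-filter _ pairs ⟩
    ∑[ p ← pairs ] (⟦ ¬? (proj₁ p Fin.≟ proj₂ p) ⟧ * ∑ (D (block (proj₁ p)) (B̃ 𝓑 (proj₂ p))) h)
      ≡⟨ ∑-cartesianProductWith _,_ (allFin m) (allFin m) ⟩
    ∑[ i ← allFin m ] ∑[ j ← allFin m ] (⟦ ¬? (i Fin.≟ j) ⟧ * ∑ (D (block i) (B̃ 𝓑 j)) h)
      ≡⟨ ∑-swap (allFin m) (allFin m) ⟩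
    ∑[ j ← allFin m ] ∑[ i ← allFin m ] (⟦ ¬? (i Fin.≟ j) ⟧ * ∑ (D (block i) (B̃ 𝓑 j)) h)
      ≡⟨ ∑-cong (allFin m) (λ j → ∑-cong (allFin m) (λ i → step i j)) ⟩
    ∑[ j ← allFin m ] ∑[ i ← allFin m ] (weight j * (⟦ ¬? (i Fin.≟ j) ⟧ * S i j))
      ≡⟨ ∑-cong (allFin m) (λ j → ∑-*ˡ (weight j) (allFin m)) ⟨
    ∑[ j ← allFin m ] (weight j * (∑[ i ← allFin m ] (⟦ ¬? (i Fin.≟ j) ⟧ * S i j)))
      ∎
    where
    open ≡-Reasoning
    pairs : List (Fin m × Fin m)
    pairs = cartesianProduct (allFin m) (allFin m)
    S : Fin m → Fin m → ℕ
    S i j = ∑[ u ← block i ] ∑[ g ← block j ] h (u ⊖ g)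
    step : ∀ i j → ⟦ ¬? (i Fin.≟ j) ⟧ * ∑ (D (block i) (B̃ 𝓑 j)) h ≡ weight j * (⟦ ¬? (i Fin.≟ j) ⟧ * S i j)
    step i j = begin
      ⟦ ¬? (i Fin.≟ j) ⟧ * ∑ (D (block i) (B̃ 𝓑 j)) h
        ≡⟨ cong (⟦ ¬? (i Fin.≟ j) ⟧ *_) (∑-cartesianProductWith _⊖_ (block i) (B̃ 𝓑 j)) ⟩
      ⟦ ¬? (i Fin.≟ j) ⟧ * (∑[ u ← block i ] ∑[ g ← B̃ 𝓑 j ] h (u ⊖ g))
        ≡⟨ cong (⟦ ¬? (i Fin.≟ j) ⟧ *_) (∑-cong (block i) (λ u → ∑-⊠ G (weight j) (block j))) ⟩
      ⟦ ¬? (i Fin.≟ j) ⟧ * (∑[ u ← block i ] (weight j * (∑[ g ← block j ] h (u ⊖ g))))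
        ≡⟨ cong (⟦ ¬? (i Fin.≟ j) ⟧ *_) (∑-*ˡ (weight j) (block i)) ⟨
      ⟦ ¬? (i Fin.≟ j) ⟧ * (weight j * S i j)
        ≡⟨ solve 3 (λ a b c → a :* (b :* c) := b :* (a :* c)) refl ⟦ ¬? (i Fin.≟ j) ⟧ (weight j) (S i j) ⟩
      weight j * (⟦ ¬? (i Fin.≟ j) ⟧ * S i j)
        ∎
      where open +-*-Solver using (solve; _:*_; _:=_)

  length-externalDifferences : length (externalDifferences 𝓑) ≡ k̃ (sizes 𝓑) * total (sizes 𝓑) * (m ∸ 1)
  length-externalDifferences = begin
    length (externalDifferences 𝓑)
      ≡⟨ ∑-one (externalDifferences 𝓑) ⟨
    ∑[ x ← externalDifferences 𝓑 ] 1
      ≡⟨ ∑-externalDifferences (λ _ → 1) ⟩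
    ∑[ j ← allFin m ] (weight j * (∑[ i ← allFin m ] (⟦ ¬? (i Fin.≟ j) ⟧ * (∑[ u ← block i ] ∑[ g ← block j ] 1))))
      ≡⟨ ∑-cong (allFin m) (λ j → trans (∑-*ˡ (weight j) (allFin m)) (∑-cong (allFin m) (λ i → step i j))) ⟩
    ∑[ j ← allFin m ] ∑[ i ← allFin m ] (k * card i * ⟦ ¬? (i Fin.≟ j) ⟧)
      -- Weight times size of block `j` is k̃ for every `j`, so a summand depends on `j` only
      -- through the condition that `j` differs from `i`, which leaves m - 1 choices for each `i`.
      ≡⟨ ∑-swap (allFin m) (allFin m) ⟩
    ∑[ i ← allFin m ] ∑[ j ← allFin m ] (k * card i * ⟦ ¬? (i Fin.≟ j) ⟧)
      ≡⟨ ∑-cong (allFin m) (λ i → trans (sym (∑-*ˡ (k * card i) (allFin m)))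
           (trans (cong (k * card i *_) (∑-allFin-≢ i)) (ℕ.*-comm (k * card i) (m ∸ 1)))) ⟩
    ∑[ i ← allFin m ] ((m ∸ 1) * (k * card i))
      ≡⟨ ∑-*ˡ (m ∸ 1) (allFin m) ⟨
    (m ∸ 1) * (∑[ i ← allFin m ] (k * card i))
      ≡⟨ cong ((m ∸ 1) *_) (∑-*ˡ k (allFin m)) ⟨
    (m ∸ 1) * (k * ∑ (allFin m) card)
      ≡⟨ ℕ.*-comm (m ∸ 1) _ ⟩
    k * ∑ (allFin m) card * (m ∸ 1)
      ≡⟨ cong (λ t → k * t * (m ∸ 1)) (sumℕ≡∑ card) ⟨
    k * total (sizes 𝓑) * (m ∸ 1)
      ∎
    where
    open ≡-Reasoning
    k : ℕ
    k = k̃ (sizes 𝓑)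
    step : ∀ i j → weight j * (⟦ ¬? (i Fin.≟ j) ⟧ * (∑[ u ← block i ] ∑[ g ← block j ] 1)) ≡ k * card i * ⟦ ¬? (i Fin.≟ j) ⟧
    step i j = begin
      weight j * (⟦ ¬? (i Fin.≟ j) ⟧ * (∑[ u ← block i ] ∑[ g ← block j ] 1))
        ≡⟨ cong (λ t → weight j * (⟦ ¬? (i Fin.≟ j) ⟧ * t)) (trans (∑-const _ (block i)) (cong (card i *_) (∑-one (block j)))) ⟩
      weight j * (⟦ ¬? (i Fin.≟ j) ⟧ * (card i * card j))
        ≡⟨ solve 4 (λ w d a b → w :* (d :* (a :* b)) := (w :* b) :* a :* d) refl (weight j) ⟦ ¬? (i Fin.≟ j) ⟧ (card i) (card j) ⟩
      weight j * card j * card i * ⟦ ¬? (i Fin.≟ j) ⟧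
        ≡⟨ cong (λ t → t * card i * ⟦ ¬? (i Fin.≟ j) ⟧) (weight*card j) ⟩
      k * card i * ⟦ ¬? (i Fin.≟ j) ⟧
        ∎
      where open +-*-Solver using (solve; _:*_; _:=_)

  -- Pairs (g , u) with g in block `j`, u in another block and g + Δ = u: the adversary's wins
  -- against source `j`, counted with their targets.
  hits : Carrier → Fin m → ℕ
  hits Δ j = ∑[ g ← block j ] ∑[ i ← allFin m ] (⟦ ¬? (i Fin.≟ j) ⟧ * (∑[ u ← block i ] ⟦ (g ⊕ Δ) ≟ u ⟧))

  multiplicity-externalDifferences : ∀ Δ →
    multiplicity Δ (externalDifferences 𝓑) ≡ ∑[ j ← allFin m ] (weight j * hits Δ j)
  multiplicity-externalDifferences Δ = begin
    multiplicity Δ (externalDifferences 𝓑)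
      ≡⟨ multiplicity≡∑ G Δ (externalDifferences 𝓑) ⟩
    ∑[ x ← externalDifferences 𝓑 ] ⟦ Δ ≟ x ⟧
      ≡⟨ ∑-externalDifferences (λ x → ⟦ Δ ≟ x ⟧) ⟩
    ∑[ j ← allFin m ] (weight j * (∑[ i ← allFin m ] (⟦ ¬? (i Fin.≟ j) ⟧ * (∑[ u ← block i ] ∑[ g ← block j ] ⟦ Δ ≟ (u ⊖ g) ⟧))))
      ≡⟨ ∑-cong (allFin m) (λ j → cong (weight j *_) (∑-cong (allFin m) (λ i → step i j))) ⟩
    ∑[ j ← allFin m ] (weight j * (∑[ i ← allFin m ] ∑[ g ← block j ] (⟦ ¬? (i Fin.≟ j) ⟧ * (∑[ u ← block i ] ⟦ (g ⊕ Δ) ≟ u ⟧))))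
      ≡⟨ ∑-cong (allFin m) (λ j → cong (weight j *_) (∑-swap (allFin m) (block j))) ⟩
    ∑[ j ← allFin m ] (weight j * hits Δ j)
      ∎
    where
    open ≡-Reasoning
    -- Moving `g` across turns a difference Δ = u - g into the adversary's shift g + Δ = u.
    transpose : ∀ u g → ⟦ Δ ≟ (u ⊖ g) ⟧ ≡ ⟦ (g ⊕ Δ) ≟ u ⟧
    transpose u g = ⟦⟧-cong (Δ ≟ (u ⊖ g)) ((g ⊕ Δ) ≟ u)
      (λ Δ≈u⊖g → ≈-trans (comm g Δ) (≈-trans (∙-congʳ Δ≈u⊖g) (//-rightDividesˡ g u)))
      (λ g⊕Δ≈u → ≈-trans (≈-sym (//-rightDividesʳ g Δ)) (∙-congʳ (≈-trans (comm Δ g) g⊕Δ≈u)))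
    step : ∀ i j → ⟦ ¬? (i Fin.≟ j) ⟧ * (∑[ u ← block i ] ∑[ g ← block j ] ⟦ Δ ≟ (u ⊖ g) ⟧) ≡
                   ∑[ g ← block j ] (⟦ ¬? (i Fin.≟ j) ⟧ * (∑[ u ← block i ] ⟦ (g ⊕ Δ) ≟ u ⟧))
    step i j = begin
      ⟦ ¬? (i Fin.≟ j) ⟧ * (∑[ u ← block i ] ∑[ g ← block j ] ⟦ Δ ≟ (u ⊖ g) ⟧)
        ≡⟨ cong (⟦ ¬? (i Fin.≟ j) ⟧ *_) (∑-cong (block i) (λ u → ∑-cong (block j) (transpose u))) ⟩
      ⟦ ¬? (i Fin.≟ j) ⟧ * (∑[ u ← block i ] ∑[ g ← block j ] ⟦ (g ⊕ Δ) ≟ u ⟧)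
        ≡⟨ cong (⟦ ¬? (i Fin.≟ j) ⟧ *_) (∑-swap (block i) (block j)) ⟩
      ⟦ ¬? (i Fin.≟ j) ⟧ * (∑[ g ← block j ] ∑[ u ← block i ] ⟦ (g ⊕ Δ) ≟ u ⟧)
        ≡⟨ ∑-*ˡ ⟦ ¬? (i Fin.≟ j) ⟧ (block j) ⟩
      ∑[ g ← block j ] (⟦ ¬? (i Fin.≟ j) ⟧ * (∑[ u ← block i ] ⟦ (g ⊕ Δ) ≟ u ⟧))
        ∎

  ∈ₚ⇒∈ : ∀ {x xs} → x ∈ₚ xs → x ∈ xs
  ∈ₚ⇒∈ = Any.map (λ { refl → ≈-refl })

  multiplicity-𝟘 : multiplicity 𝟘 (externalDifferences 𝓑) ≡ 0
  multiplicity-𝟘 = begin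
    multiplicity 𝟘 (externalDifferences 𝓑)       ≡⟨ multiplicity-externalDifferences 𝟘 ⟩
    ∑[ j ← allFin m ] (weight j * hits 𝟘 j)      ≡⟨ ∑-cong (allFin m) (λ j → trans (cong (weight j *_) (hits-𝟘 j)) (ℕ.*-zeroʳ (weight j))) ⟩
    ∑[ j ← allFin m ] 0                          ≡⟨ ∑-zero (allFin m) ⟩
    0                                            ∎
    where
    open ≡-Reasoning
    hits-𝟘 : ∀ j → hits 𝟘 j ≡ 0
    hits-𝟘 j = trans (∑-cong-∈ (block j) λ {g} g∈ → trans (∑-cong (allFin m) λ i →
        ⟦⟧-*-zero (¬? (i Fin.≟ j)) λ i≢j → trans (∑-cong-∈ (block i) λ {u} u∈ →
          ⟦⟧-false ((g ⊕ 𝟘) ≟ u) λ g≈u → disjoint i≢j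
            ( ∈ₚ⇒∈ u∈
            , Any.map (≈-trans (≈-trans (≈-sym g≈u) (identityʳ g))) (∈ₚ⇒∈ g∈)))
          (∑-zero (block i)))
        (∑-zero (allFin m)))
      (∑-zero (block j))

-- Codes

module _ {n m : ℕ} (𝓒 : WeakAMDCode n m) where
  open WeakAMDCode 𝓒
  open FiniteAbelianGroup G hiding (sym; trans; refl)
  open DisjointFamily 𝓐
  private
    module S = Inverse sources
    to-injective = Injection.injective (Inverse⇒Injection sources)

  -- The blocks are repetition-free and pairwise disjoint, and distinct indices name distinct
  -- sources. This guarantees at most one target for each shifted element.
  others-unique : ∀ s → Unique (others s)
  others-unique s = SetoidUnique.concat⁺ setoid
    (All.map⁺ (All.universal unique _))
    (AllPairs.map⁺ (AllPairs.filter⁺ _ (AllPairs.map⁺ blocks-disjoint)))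
    where
    blocks-disjoint : AllPairs (λ i j → Disjoint (block (S.to i)) (block (S.to j))) (allFin m)
    blocks-disjoint = AllPairs.map (λ i≢j {_} → disjoint (i≢j ∘ to-injective)) (Unique.allFin⁺ m)

  ∑-others : ∀ j (f : Carrier → ℕ) → ∑ (others (S.to j)) f ≡
    (∑[ i ← allFin m ] (⟦ ¬? (i Fin.≟ j) ⟧ * ∑ (block (S.to i)) f))
  ∑-others j f = begin
    ∑ (others (S.to j)) f
      ≡⟨ ∑-concatMap block (filter _ (map S.to (allFin m))) ⟩
    ∑ (filter _ (map S.to (allFin m))) (λ s → ∑ (block s) f)
      ≡⟨ ∑-filter _ (map S.to (allFin m)) ⟩
    ∑ (map S.to (allFin m)) _
      ≡⟨ ∑-map S.to (allFin m) ⟩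
    ∑ (allFin m) _
      ≡⟨ ∑-cong (allFin m) (λ i → cong (_* ∑ (block (S.to i)) f) (⟦⟧-cong (¬? (S.to i ≟ₛ S.to j)) (¬? (i Fin.≟ j))
           (λ ≢ i≡j → ≢ (cong S.to i≡j)) (λ i≢j → i≢j ∘ to-injective))) ⟩
    ∑[ i ← allFin m ] (⟦ ¬? (i Fin.≟ j) ⟧ * ∑ (block (S.to i)) f)
      ∎
    where
    open ≡-Reasoning
    -- This must unfold to the decision procedure inside `others`, since the indicators being
    -- rewritten come from its filter.
    _≟ₛ_ = via-injection (Inverse⇒Injection (↔-sym sources)) Fin._≟_

  -- Membership of g + Δ among the other blocks equals the number of targets it meets there, because
  -- that number is at most one.
  wins≡hits : ∀ Δ j → wins Δ (S.to j) ≡ hits family Δ j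
  wins≡hits Δ j = begin
    wins Δ (S.to j)
      ≡⟨ length-filter≡∑ (λ g → (g ⊕ Δ) ∈? others (S.to j)) (block (S.to j)) ⟩
    ∑[ g ← block (S.to j) ] ⟦ (g ⊕ Δ) ∈? others (S.to j) ⟧
      ≡⟨ ∑-cong (block (S.to j)) (λ g → ∑-indicator decSetoid (others-unique (S.to j)) (g ⊕ Δ) ((g ⊕ Δ) ∈? others (S.to j))) ⟨
    ∑[ g ← block (S.to j) ] ∑[ u ← others (S.to j) ] ⟦ (g ⊕ Δ) ≟ u ⟧
      ≡⟨ ∑-cong (block (S.to j)) (λ g → ∑-others j (λ u → ⟦ (g ⊕ Δ) ≟ u ⟧)) ⟩
    hits family Δ j
      ∎
    where open ≡-Reasoning

  -- The factor `m` cancels the uniform choice of source. Writing k̃ as weight times size of block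
  -- `j` cancels the uniform choice within that block and leaves exactly the weight.
  k̃*m*winProbability : .{{_ : NonZero m}} → ∀ Δ →
    fromℕ (k̃ (sizes family) * m) ℚ.* winProbability Δ ≡ fromℕ (multiplicity Δ (externalDifferences family))
  k̃*m*winProbability Δ = begin
    fromℕ (k * m) ℚ.* ((+ 1 ℚ./ m) ℚ.* sumℚ terms)
      ≡⟨ cong (ℚ._* ((+ 1 ℚ./ m) ℚ.* sumℚ terms)) (fromℕ-* k m) ⟩
    (fromℕ k ℚ.* fromℕ m) ℚ.* ((+ 1 ℚ./ m) ℚ.* sumℚ terms)
      ≡⟨ ℚ.*-assoc (fromℕ k) (fromℕ m) _ ⟩
    fromℕ k ℚ.* (fromℕ m ℚ.* ((+ 1 ℚ./ m) ℚ.* sumℚ terms))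
      ≡⟨ cong (fromℕ k ℚ.*_) (cancel m (sumℚ terms)) ⟩
    fromℕ k ℚ.* sumℚ terms
      ≡⟨ ℚSum.*-distribˡ-sum (fromℕ k) terms ⟩
    sumℚ (λ j → fromℕ k ℚ.* terms j)
      ≡⟨ ℚSum.sum-cong-≗ scaledTerm ⟩
    sumℚ (λ j → fromℕ (weight family j * hits family Δ j))
      ≡⟨ fromℕ-sum (λ j → weight family j * hits family Δ j) ⟩
    fromℕ (sumℕ (λ j → weight family j * hits family Δ j))
      ≡⟨ cong fromℕ (trans (sumℕ≡∑ (λ j → weight family j * hits family Δ j))
           (sym (multiplicity-externalDifferences family Δ))) ⟩
    fromℕ (multiplicity Δ (externalDifferences family))
      ∎
    where
    open ≡-Reasoning
    k : ℕ
    k = k̃ (sizes family)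
    terms : Vector ℚ m
    terms j = (+ 1 ℚ./ card (S.to j)) {{nonempty (S.to j)}} ℚ.* fromℕ (wins Δ (S.to j))
    cancel : ∀ q .{{_ : NonZero q}} x → fromℕ q ℚ.* ((+ 1 ℚ./ q) ℚ.* x) ≡ x
    cancel q x = trans (sym (ℚ.*-assoc (fromℕ q) (+ 1 ℚ./ q) x))
      (trans (cong (ℚ._* x) (fromℕ-*-/ 1 q)) (ℚ.*-identityˡ x))
    scaledTerm : ∀ j → fromℕ k ℚ.* terms j ≡ fromℕ (weight family j * hits family Δ j)
    scaledTerm j = begin
      fromℕ k ℚ.* terms j
        ≡⟨ cong (λ t → fromℕ t ℚ.* terms j) (weight*card family j) ⟨
      fromℕ (weight family j * card (S.to j)) ℚ.* terms j
        ≡⟨ cong (ℚ._* terms j) (fromℕ-* (weight family j) (card (S.to j))) ⟩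
      (fromℕ (weight family j) ℚ.* fromℕ (card (S.to j))) ℚ.* terms j
        ≡⟨ ℚ.*-assoc (fromℕ (weight family j)) (fromℕ (card (S.to j))) (terms j) ⟩
      fromℕ (weight family j) ℚ.* (fromℕ (card (S.to j)) ℚ.* terms j)
        ≡⟨ cong (fromℕ (weight family j) ℚ.*_) (cancel (card (S.to j)) {{nonempty (S.to j)}} (fromℕ (wins Δ (S.to j)))) ⟩
      fromℕ (weight family j) ℚ.* fromℕ (wins Δ (S.to j))
        ≡⟨ fromℕ-* (weight family j) (wins Δ (S.to j)) ⟨
      fromℕ (weight family j * wins Δ (S.to j))
        ≡⟨ cong (λ t → fromℕ (weight family j * t)) (wins≡hits Δ j) ⟩
      fromℕ (weight family j * hits family Δ j)
        ∎

-- The parameter λ as a maximal multiplicity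

module _ {n m : ℕ} {G : FiniteAbelianGroup n} (𝓑 : DisjointFamily G (Fin m)) where
  open FiniteAbelianGroup G renaming (sym to ≈-sym; trans to ≈-trans; refl to ≈-refl)
  private module E = Inverse enumeration

  -- Mirrors the definition of ρ with multiplicities in place of winning probabilities, so that
  -- scaling by k̃ m carries one maximum to the other.
  IsMaxMultiplicity : ℕ → Set
  IsMaxMultiplicity = IsGreatest _≤_ λ l →
    Σ[ Δ ∈ Carrier ] Δ ≉ 𝟘 × l ≡ multiplicity Δ (externalDifferences 𝓑)

  total-nonZero : .{{_ : NonZero m}} → NonZero (total (sizes 𝓑))
  total-nonZero = go (DisjointFamily.card 𝓑) (DisjointFamily.nonempty 𝓑)
    where
    go : ∀ {m} .{{_ : NonZero m}} (k : Vector ℕ m) → (∀ i → NonZero (k i)) → NonZero (sumℕ k)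
    go {suc m} k k≢0 = ℕ.>-nonZero (ℕ.<-≤-trans (ℕ.>-nonZero⁻¹ _ {{k≢0 Fin.zero}}) (ℕ.m≤m+n _ _))

  module _ (2≤m : 2 ≤ m) where

    length-externalDifferences-nonZero : NonZero (length (externalDifferences 𝓑))
    length-externalDifferences-nonZero = subst NonZero (sym (length-externalDifferences 𝓑))
      (ℕ.m*n≢0 _ (m ∸ 1) {{ℕ.m*n≢0 _ _ {{lcms-nonZero m _ (positive (sizes 𝓑))}} {{total-nonZero}}}})
      where
      instance
        m≢0 : NonZero m
        m≢0 = ℕ.>-nonZero (ℕ.≤-trans (ℕ.n≤1+n 1) 2≤m)
        m∸1≢0 : NonZero (m ∸ 1)
        m∸1≢0 = ℕ.>-nonZero (ℕ.∸-monoˡ-≤ 1 2≤m)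

    -- The total number of differences is positive and zero is not among them. Any bound on the
    -- multiplicities is therefore positive, as λ is required to be.
    externalDifference-exists : ∃[ Δ ] Δ ≉ 𝟘 × multiplicity Δ (externalDifferences 𝓑) ≢ 0
    externalDifference-exists =
      let Δ , mult≢0 = ∑-positive (elements G) (λ Δ → multiplicity Δ (externalDifferences 𝓑))
            (λ ∑≡0 → ℕ.≢-nonZero⁻¹ _ {{length-externalDifferences-nonZero}}
              (trans (sym (∑-multiplicity G (externalDifferences 𝓑))) ∑≡0))
      in Δ , (λ Δ≈0 → mult≢0 (trans (multiplicity-cong G (externalDifferences 𝓑) Δ≈0) (multiplicity-𝟘 𝓑))) , mult≢0

    maxMultiplicity⇒BSWEDF : ∀ {K a l} → HasSizes 𝓑 K → total K ≡ a → IsMaxMultiplicity l → IsBSWEDF 𝓑 K a l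
    maxMultiplicity⇒BSWEDF {l = l} hasSizes total≡a ((Δ , _ , l≡mult) , max) = record
      { has-sizes  = hasSizes
      ; total-size = total≡a
      ; minimal    =
          ( ℕ.<-≤-trans (ℕ.n≢0⇒n>0 (proj₂ (proj₂ externalDifference-exists))) (mult≤l _ (proj₁ (proj₂ externalDifference-exists)))
          , ⊆ₘ-⊠G∖0 G (externalDifferences 𝓑) (multiplicity-𝟘 𝓑) mult≤l )
          , λ l′ (_ , ⊆l′) → subst (_≤ l′) (sym l≡mult) (⊠G∖0-bound G (externalDifferences 𝓑) l′ ⊆l′ Δ)
      }
      where
      mult≤l : ∀ x → x ≉ 𝟘 → multiplicity x (externalDifferences 𝓑) ≤ l
      mult≤l x x≉0 = max _ (x , x≉0 , refl)

    -- Were `l` not attained, all multiplicities would be at most l - 1, and this smaller value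
    -- would be admissible as well.
    BSWEDF⇒maxMultiplicity : ∀ {K a l} → IsBSWEDF 𝓑 K a l → IsMaxMultiplicity l
    BSWEDF⇒maxMultiplicity {l = l} isBSWEDF
      with (0<l , ⊆l) , least ← IsBSWEDF.minimal isBSWEDF
      -- Attainment is decidable by searching the enumeration of the finite group.
      with Fin.any? (λ i → ¬? (E.to i ≟ 𝟘) ×-dec (l ℕ.≟ multiplicity (E.to i) (externalDifferences 𝓑)))
    ... | yes (i , to≉0 , l≡) = (E.to i , to≉0 , l≡) , λ { _ (Δ , _ , refl) → ⊠G∖0-bound G (externalDifferences 𝓑) l ⊆l Δ }
    ... | no unattained = contradiction
      (least (ℕ.pred l)
        -- Admissibility of l - 1 includes positivity: it bounds the multiplicity of an existing
        -- difference.
        ( ℕ.<-≤-trans (ℕ.n≢0⇒n>0 (proj₂ (proj₂ externalDifference-exists))) (mult≤pred _ (proj₁ (proj₂ externalDifference-exists)))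
        , ⊆ₘ-⊠G∖0 G (externalDifferences 𝓑) (multiplicity-𝟘 𝓑) mult≤pred ))
      (ℕ.<⇒≱ (ℕ.≤-reflexive (ℕ.suc-pred l {{ℕ.>-nonZero 0<l}})))
      where
      mult≤pred : ∀ x → x ≉ 𝟘 → multiplicity x (externalDifferences 𝓑) ≤ ℕ.pred l
      mult≤pred x x≉0 = ℕ.<⇒≤pred (ℕ.≤∧≢⇒< (⊠G∖0-bound G (externalDifferences 𝓑) l ⊆l x) λ mult≡l →
        unattained (E.from x , (λ to≈0 → x≉0 (≈-trans (x≈to∘from G x) to≈0)) ,
          trans (sym mult≡l) (multiplicity-cong G (externalDifferences 𝓑) (x≈to∘from G x))))

-- Passing between codes and bounded families

module _ {n m : ℕ} .{{_ : NonZero m}} where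

  module _ (2≤m : 2 ≤ m) (𝓒 : WeakAMDCode n m) where
    open WeakAMDCode 𝓒
    open FiniteAbelianGroup G using (multiplicity)

    private
      scaled-winProbability : ∀ {K} → HasSizes family K → ∀ Δ →
        fromℕ (multiplicity Δ (externalDifferences family)) ≡ fromℕ (k̃ K * m) ℚ.* winProbability Δ
      scaled-winProbability hasSizes Δ = trans (sym (k̃*m*winProbability 𝓒 Δ))
        (cong (λ k → fromℕ (k * m) ℚ.* winProbability Δ) (lcms-cong hasSizes))

    weakAMD⇒BSWEDF : ∀ {K a ρ} → HasSizes family K → total K ≡ a → IsWeakAMD 𝓒 a ρ →
      ∃[ l ] fromℕ l ≡ fromℕ (k̃ K * m) ℚ.* ρ × IsBSWEDF family K a l
    weakAMD⇒BSWEDF {K} {a} {ρ} hasSizes total≡a isWeakAMD =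
      let (Δ , Δ≉0 , ρ≡) , max = IsWeakAMD.maximal isWeakAMD
          -- A priori k̃ m ρ is only rational; the multiplicity at a maximising Δ exhibits it as a
          -- natural number.
          l  = multiplicity Δ (externalDifferences family)
          l≡ = trans (scaled-winProbability {K} hasSizes Δ) (cong (fromℕ (k̃ K * m) ℚ.*_) (sym ρ≡))
      in l , l≡ , maxMultiplicity⇒BSWEDF family 2≤m hasSizes total≡a
          ( (Δ , Δ≉0 , refl)
          , λ l′ (Δ′ , Δ′≉0 , l′≡) → subst (_≤ l) (sym l′≡)
              (unscale-≤ (k̃ K * m) {{k̃*m≢0 K}} (scaled-winProbability {K} hasSizes Δ′) l≡
                (max (winProbability Δ′) (Δ′ , Δ′≉0 , refl))) )

    BSWEDF⇒weakAMD : ∀ {K a l ρ} → IsBSWEDF family K a l → fromℕ l ≡ fromℕ (k̃ K * m) ℚ.* ρ → IsWeakAMD 𝓒 a ρ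
    BSWEDF⇒weakAMD {K} {a} {l} {ρ} isBSWEDF l≡ =
      let (Δ , Δ≉0 , l≡mult) , max = BSWEDF⇒maxMultiplicity family 2≤m isBSWEDF
      in record
        { total-size = trans (sumℕ-cong has-sizes) total-size
        ; maximal    =
            ( Δ , Δ≉0 , fromℕ-*-cancelˡ (k̃ K * m) {{k̃*m≢0 K}}
                (trans (sym l≡) (trans (cong fromℕ l≡mult) (scaled-winProbability {K} has-sizes Δ))) )
          , λ ρ′ (Δ′ , Δ′≉0 , ρ′≡) → subst (ℚ._≤ ρ) (sym ρ′≡)
              (scale-≤ (k̃ K * m) {{k̃*m≢0 K}} (scaled-winProbability {K} has-sizes Δ′) l≡
                (max (multiplicity Δ′ (externalDifferences family)) (Δ′ , Δ′≉0 , refl)))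
        }
      where open IsBSWEDF isBSWEDF using (has-sizes; total-size)

  toCode : {G : FiniteAbelianGroup n} → DisjointFamily G (Fin m) → WeakAMDCode n m
  toCode {G = G} 𝓑 = record { S = Fin m ; sources = ↔-refl ; G = G ; 𝓐 = 𝓑 }

  BSWEDF⇒code : 2 ≤ m → ∀ {K a l ρ} → BSWEDFExists n m K a l → fromℕ l ≡ fromℕ (k̃ K * m) ℚ.* ρ →
    Σ[ 𝓒 ∈ WeakAMDCode n m ] HasSizes (WeakAMDCode.family 𝓒) K × IsWeakAMD 𝓒 a ρ
  -- family (toCode 𝓑) and 𝓑 have the same blocks but are not definitionally equal.
  BSWEDF⇒code 2≤m {K} {a} {l} (G , 𝓑 , isBSWEDF) l≡ = toCode 𝓑 , has-sizes , BSWEDF⇒weakAMD 2≤m (toCode 𝓑) {K} {a} {l}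
    (record { has-sizes = has-sizes ; total-size = total-size ; minimal = minimal }) l≡
    where open IsBSWEDF isBSWEDF

  -- Each competitor on one side yields a competitor on the other, possibly over another group of
  -- order `n`. Both have the same `K`, so the common factor k̃ m preserves and reflects the
  -- comparison.
  minRho⇔optimal : 2 ≤ m → ∀ {K l ρ} (𝓒 : WeakAMDCode n m) → HasSizes (WeakAMDCode.family 𝓒) K →
    IsWeakAMD 𝓒 (total K) ρ → fromℕ l ≡ fromℕ (k̃ K * m) ℚ.* ρ →
    IsBSWEDF (WeakAMDCode.family 𝓒) K (total K) l →
    IsMinRhoOfSizes n m K ρ ⇔ Optimal n m K l
  minRho⇔optimal 2≤m {K} 𝓒 hasSizes isWeakAMD l≡ isBSWEDF = mk⇔
    (λ (_ , least) → (_ , _ , isBSWEDF) , λ l′ exists →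
      unscale-≤ (k̃ K * m) {{k̃*m≢0 K}} l≡ (normalised-scaled K l′)
        (least _ (BSWEDF⇒code 2≤m exists (normalised-scaled K l′))))
    (λ (_ , least) → (𝓒 , hasSizes , isWeakAMD) , λ ρ′ (𝓒′ , hasSizes′ , isWeakAMD′) →
      let l′ , l′≡ , isBSWEDF′ = weakAMD⇒BSWEDF 2≤m 𝓒′ hasSizes′ refl isWeakAMD′
      in scale-≤ (k̃ K * m) {{k̃*m≢0 K}} l≡ l′≡ (least l′ (_ , _ , isBSWEDF′)))

  -- The Paterson-Stinson value and exactness

  module _ .{{_ : NonZero (n ∸ 1)}} where

    -- For k = k̃ the right-hand side is the number of external differences. The extra factor n - 1,
    -- the number of nonzero group elements, makes the identity one between natural numbers.
    patersonStinson-scaled : ∀ k a → fromℕ (n ∸ 1) ℚ.* (fromℕ (k * m) ℚ.* patersonStinson n m a) ≡ fromℕ (k * a * (m ∸ 1))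
    patersonStinson-scaled k a = begin
      fromℕ (n ∸ 1) ℚ.* (fromℕ (k * m) ℚ.* PS)    ≡⟨ ℚ.*-assoc (fromℕ (n ∸ 1)) (fromℕ (k * m)) PS ⟨
      (fromℕ (n ∸ 1) ℚ.* fromℕ (k * m)) ℚ.* PS    ≡⟨ cong (ℚ._* PS) (fromℕ-* (n ∸ 1) (k * m)) ⟨
      fromℕ ((n ∸ 1) * (k * m)) ℚ.* PS              ≡⟨ cong (λ t → fromℕ t ℚ.* PS) reorder ⟩
      fromℕ (k * (m * (n ∸ 1))) ℚ.* PS              ≡⟨ cong (ℚ._* PS) (fromℕ-* k (m * (n ∸ 1))) ⟩
      (fromℕ k ℚ.* fromℕ (m * (n ∸ 1))) ℚ.* PS     ≡⟨ ℚ.*-assoc (fromℕ k) (fromℕ (m * (n ∸ 1))) PS ⟩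
      fromℕ k ℚ.* (fromℕ (m * (n ∸ 1)) ℚ.* PS)     ≡⟨ cong (fromℕ k ℚ.*_) (fromℕ-*-/ (a * (m ∸ 1)) (m * (n ∸ 1)) {{ℕ.m*n≢0 m (n ∸ 1)}}) ⟩
      fromℕ k ℚ.* fromℕ (a * (m ∸ 1))               ≡⟨ fromℕ-* k (a * (m ∸ 1)) ⟨
      fromℕ (k * (a * (m ∸ 1)))                      ≡⟨ cong fromℕ (ℕ.*-assoc k a (m ∸ 1)) ⟨
      fromℕ (k * a * (m ∸ 1))                        ∎
      where
      open ≡-Reasoning
      open +-*-Solver using (solve; _:*_; _:=_)
      PS = patersonStinson n m a
      reorder : (n ∸ 1) * (k * m) ≡ k * (m * (n ∸ 1))
      reorder = solve 3 (λ N k m → N :* (k :* m) := k :* (m :* N)) refl (n ∸ 1) k m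

    patersonStinson-/ : ∀ k a → fromℕ (k * m) ℚ.* patersonStinson n m a ≡ + (k * a * (m ∸ 1)) ℚ./ (n ∸ 1)
    patersonStinson-/ k a = fromℕ-*-cancelˡ (n ∸ 1)
      (trans (patersonStinson-scaled k a) (sym (fromℕ-*-/ (k * a * (m ∸ 1)) (n ∸ 1))))

    -- l ⊠ G∖0 contains the external differences and has the same number of elements.
    BSWEDF⇒SWEDF : ∀ {G : FiniteAbelianGroup n} (𝓑 : DisjointFamily G (Fin m)) {K a l} → IsBSWEDF 𝓑 K a l →
      fromℕ l ≡ fromℕ (k̃ (sizes 𝓑) * m) ℚ.* patersonStinson n m (total (sizes 𝓑)) → IsSWEDF 𝓑 K a l
    BSWEDF⇒SWEDF {G = G} 𝓑 {l = l} isBSWEDF l≡ = record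
      { isBSWEDF = isBSWEDF
      ; exact    = length-tight⇒≈ₘ G (externalDifferences 𝓑) (l ⊠ G∖0)
          (proj₂ (proj₁ (IsBSWEDF.minimal isBSWEDF))) (ℕ.≤-reflexive (begin
          length (l ⊠ G∖0)                                          ≡⟨ length-⊠ G l G∖0 ⟩
          l * length G∖0                                            ≡⟨ cong (l *_) (length-G∖0 G) ⟩
          l * (n ∸ 1)                                               ≡⟨ ℕ.*-comm l (n ∸ 1) ⟩
          (n ∸ 1) * l                                               ≡⟨ fromℕ-injective (trans (fromℕ-* (n ∸ 1) l)
            (trans (cong (fromℕ (n ∸ 1) ℚ.*_) l≡) (patersonStinson-scaled (k̃ (sizes 𝓑)) (total (sizes 𝓑))))) ⟩
          k̃ (sizes 𝓑) * total (sizes 𝓑) * (m ∸ 1)                  ≡⟨ length-externalDifferences 𝓑 ⟨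
          length (externalDifferences 𝓑)                            ∎))
      }
      where
      open ≡-Reasoning
      open FiniteAbelianGroup G using (_⊠_; G∖0)

corollary3 : (n m : ℕ) .{{_ : NonZero n}} .{{_ : NonZero m}} → 2 ≤ m →
    ( (K : Sizes m) (𝓒 : WeakAMDCode n m) (ρ : ℚ) →
    HasSizes (WeakAMDCode.family 𝓒) K →
    IsWeakAMD 𝓒 (total K) ρ →
    ∃[ l ] fromℕ l ≡ fromℕ (k̃ K * m) ℚ.* ρ
    × IsBSWEDF (WeakAMDCode.family 𝓒) K (total K) l
    × (IsMinRhoOfSizes n m K ρ ⇔ Optimal n m K l) )
    ×
    ( (a : ℕ) →
    ( Σ[ 𝓒 ∈ WeakAMDCode n m ] ∃[ ρ ] IsWeakAMD 𝓒 a ρ × IsMinRho n m a ρ )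
    ⇔
    ( Σ[ K ∈ Sizes m ] total K ≡ a × (∃[ l ] BSWEDFExists n m K a l × StronglyOptimal n m a K l
    × (∃[ ρ ] IsMinRho n m a ρ × fromℕ l ≡ fromℕ (k̃ K * m) ℚ.* ρ)) ) )
    ×
    ( .{{_ : NonZero (n ∸ 1)}} (a : ℕ) →
    ( Σ[ 𝓒 ∈ WeakAMDCode n m ] IsWeakAMD 𝓒 a (patersonStinson n m a) )
    ⇔
    ( Σ[ K ∈ Sizes m ] total K ≡ a × (∃[ l ] fromℕ l ≡ + (k̃ K * a * (m ∸ 1)) ℚ./ (n ∸ 1)
    × (Σ[ G ∈ FiniteAbelianGroup n ] Σ[ 𝓑 ∈ DisjointFamily G (Fin m) ] IsSWEDF 𝓑 K a l)) ) )
corollary3 n m 2≤m =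
    (λ K 𝓒 ρ hasSizes isWeakAMD →
      let l , l≡ , isBSWEDF = weakAMD⇒BSWEDF 2≤m 𝓒 hasSizes refl isWeakAMD
      in l , l≡ , isBSWEDF , minRho⇔optimal 2≤m 𝓒 hasSizes isWeakAMD l≡ isBSWEDF)
  , (λ a → mk⇔
      (λ (𝓒 , ρ , isWeakAMD , isMin) →
        let K = sizes (WeakAMDCode.family 𝓒)
            total≡a = IsWeakAMD.total-size isWeakAMD
            l , l≡ , isBSWEDF = weakAMD⇒BSWEDF 2≤m 𝓒 {K} (λ _ → refl) total≡a isWeakAMD
        in K , total≡a , l , (_ , _ , isBSWEDF)
         -- The normalised λ is the ρ of the code, so minimality transfers by rewriting.
         , subst (IsMinRho n m a) (normalised-unique K l l≡) isMin , ρ , isMin , l≡)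
      (λ (K , _ , l , exists , stronglyOptimal , _) →
        -- The code built on the family has the normalised λ as its ρ, and strong optimality says
        -- that this value is minimal.
        let 𝓒 , _ , isWeakAMD = BSWEDF⇒code 2≤m exists (normalised-scaled K l)
        in 𝓒 , normalised m K l , isWeakAMD , stronglyOptimal))
  , (λ a → mk⇔
      -- Matching on `refl` replaces `a` by the total block size of the family, the form in which
      -- the external differences were counted.
      (λ { (𝓒 , isWeakAMD@record { total-size = refl }) →
        let K = sizes (WeakAMDCode.family 𝓒)
            l , l≡ , isBSWEDF = weakAMD⇒BSWEDF 2≤m 𝓒 {K} (λ _ → refl) refl isWeakAMD
        in K , refl , l , trans l≡ (patersonStinson-/ {n = n} (k̃ K) (total K)) , _ , _ , BSWEDF⇒SWEDF (WeakAMDCode.family 𝓒) isBSWEDF l≡ })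
      (λ (K , _ , l , l≡ , _ , _ , isSWEDF) →
        let 𝓒 , _ , isWeakAMD = BSWEDF⇒code 2≤m (_ , _ , IsSWEDF.isBSWEDF isSWEDF)
              (trans l≡ (sym (patersonStinson-/ {n = n} (k̃ K) a)))
        in 𝓒 , isWeakAMD))
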